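{- The Petersen graph is $4$-ordered.
   Context: A simple graph $G$ is called $k$-ordered if for every sequence $v_1,\ldots,v_k$ of $k$ distinct vertices of $G$ there exists a cycle in $G$ containing these $k$ vertices in the specified (cyclic) order. The Petersen graph is the $3$-regular graph on $10$ vertices consisting of an outer $5$-cycle $B_1B_2B_3B_4B_5$, an inner "pentagram" on $A_1,\ldots,A_5$ with $A_i$ adjacent to $A_{i\pm 2 \bmod 5}$, and the edges $A_iB_i$ for $i=1,\ldots,5$. -}

module Defs where

open import Data.Fin.Base using (Fin; toℕ)
open import Data.Fin.Properties using (all?; _≟_)
open import Data.List.Base using (List; []; _∷_; _++_; _∷ʳ_; length)
open import Data.List.Relation.Binary.Sublist.Propositional using (_⊆_)
open import Data.List.Relation.Unary.Linked using (Linked)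
import Data.List.Relation.Unary.Unique.Propositional as List
open import Data.Nat.Base using (ℕ; _+_; _≤_)
open import Data.Nat.DivMod using (_mod_)
open import Data.Product.Base using (∃-syntax; _×_)
open import Data.Sum.Base using (_⊎_; [_,_]; swap)
open import Data.Vec.Base using (Vec; toList)
import Data.Vec.Relation.Unary.Unique.Propositional as Vec
open import Level using (0ℓ)
open import Relation.Binary.Core using (Rel)
open import Relation.Binary.Definitions using (Symmetric; Irreflexive)
open import Relation.Binary.PropositionalEquality using (_≡_; _≢_; refl; sym)
open import Relation.Nullary.Decidable using (from-yes; ¬?)

record SimpleGraph : Set₁ where
  field
    Vertex : Set
    Adj    : Rel Vertex 0ℓ
    symm   : Symmetric Adj
    irrefl : Irreflexive _≡_ Adj

-- A cycle is given by its vertices listed once around, from an arbitrary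
-- starting vertex and in one of its two directions; `closed` includes the
-- edge from the last vertex back to the first.
record Cycle (G : SimpleGraph) : Set where
  open SimpleGraph G
  field
    start    : Vertex
    rest     : List Vertex
  vertices : List Vertex
  vertices = start ∷ rest
  field
    long     : 3 ≤ length vertices
    distinct : List.Unique vertices
    closed   : Linked Adj (vertices ∷ʳ start)

-- `ys ++ xs` ranges over the rotations of the vertex list, and `_⊆_` is the
-- order-preserving sublist relation: starting from a suitable vertex and going
-- once around the cycle, one meets the entries of vs in the order listed.
ContainsInCyclicOrder : {G : SimpleGraph} → Cycle G →
                        List (SimpleGraph.Vertex G) → Set
ContainsInCyclicOrder C vs =
  ∃[ xs ] ∃[ ys ] (Cycle.vertices C ≡ xs ++ ys × vs ⊆ ys ++ xs)

Ordered : ℕ → SimpleGraph → Set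
Ordered k G = (vs : Vec (SimpleGraph.Vertex G) k) → Vec.Unique vs →
              ∃[ C ] ContainsInCyclicOrder {G} C (toList vs)

-- Indices are residues mod 5, so the usual index 5 is represented by 0.
data PetersenVertex : Set where
  A B : Fin 5 → PetersenVertex

infixl 6 _⊕_
_⊕_ : Fin 5 → ℕ → Fin 5
i ⊕ k = (toℕ i + k) mod 5

PetersenAdj : Rel PetersenVertex 0ℓ
PetersenAdj (B i) (B j) = j ≡ i ⊕ 1 ⊎ i ≡ j ⊕ 1
PetersenAdj (A i) (A j) = j ≡ i ⊕ 2 ⊎ i ≡ j ⊕ 2
PetersenAdj (A i) (B j) = i ≡ j
PetersenAdj (B i) (A j) = i ≡ j

PetersenAdj-symm : Symmetric PetersenAdj
PetersenAdj-symm {A _} {A _} = swap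
PetersenAdj-symm {A _} {B _} = sym
PetersenAdj-symm {B _} {A _} = sym
PetersenAdj-symm {B _} {B _} = swap

PetersenAdj-irrefl : Irreflexive _≡_ PetersenAdj
PetersenAdj-irrefl {A i} refl = [ i≢i⊕2 i , i≢i⊕2 i ]
  where
  i≢i⊕2 : ∀ i → i ≢ i ⊕ 2
  i≢i⊕2 = from-yes (all? λ i → ¬? (i ≟ i ⊕ 2))
PetersenAdj-irrefl {B i} refl = [ i≢i⊕1 i , i≢i⊕1 i ]
  where
  i≢i⊕1 : ∀ i → i ≢ i ⊕ 1
  i≢i⊕1 = from-yes (all? λ i → ¬? (i ≟ i ⊕ 1))

Petersen : SimpleGraph
Petersen = record
  { Vertex = PetersenVertex
  ; Adj    = PetersenAdj
  ; symm   = PetersenAdj-symm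
  ; irrefl = PetersenAdj-irrefl
  }

{-# OPTIONS --safe #-}
module Submission where

-- Any four vertices lie in any prescribed cyclic order on a cycle of length 8
-- or 9 (both lengths are needed).  This is a finite check: it suffices to list
-- the cycles of these lengths starting at the first prescribed vertex v, in
-- both directions, and to find the other three vertices in order on the rest.

open import Defs

open import Data.Bool.Base using (true)
open import Data.Fin.Properties using (all?; _≟_)
open import Data.List.Base using (List; []; _∷_; [_]; _++_; _∷ʳ_; concatMap; filter; length; map)
open import Data.List.Properties using (++-identityʳ)
open import Data.List.Relation.Binary.Sublist.Propositional using (_⊆_) renaming (_∷_ to _∷⊆_)
open import Data.List.Relation.Unary.All as All using (All)
open import Data.List.Relation.Unary.All.Properties using (all-filter)
open import Data.List.Relation.Unary.Any using (Any; any?)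
open import Data.List.Relation.Unary.Linked using (Linked; linked?)
import Data.List.Relation.Unary.Unique.Propositional as List
open import Data.Nat.Base using (ℕ; zero; suc; _≤_)
open import Data.Nat.Properties using (_≤?_)
open import Data.Product.Base using (∃-syntax; _×_; _,_)
open import Data.Vec.Base using ([]; _∷_)
import Data.Vec.Relation.Unary.AllPairs as Vec
import Data.Vec.Relation.Unary.Unique.Propositional as Vec
open import Function.Base using (_∘_)
open import Level using (Level)
open import Relation.Binary.Definitions using (DecidableEquality)
import Relation.Binary.Definitions as Binary
open import Relation.Binary.PropositionalEquality using (_≡_; refl; sym; subst; cong)
open import Relation.Nullary.Decidable
  using (Dec; does; yes; no; map′; ¬?; _×-dec_; _⊎-dec_; _→-dec_)
open import Relation.Unary using (Pred; Decidable)

private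
  variable
    p : Level

-- Unlike `from-yes` and `toWitness`, this makes the type checker compute only
-- the Boolean, which is much faster.
does⁻ : {P : Set p} (P? : Dec P) → does P? ≡ true → P
does⁻ (yes p) refl = p

_≟ᵛ_ : DecidableEquality PetersenVertex
A i ≟ᵛ A j = map′ (cong A) (λ { refl → refl }) (i ≟ j)
A _ ≟ᵛ B _ = no λ ()
B _ ≟ᵛ A _ = no λ ()
B i ≟ᵛ B j = map′ (cong B) (λ { refl → refl }) (i ≟ j)

open import Data.List.Membership.DecPropositional _≟ᵛ_ using (_∉?_)
open import Data.List.Relation.Binary.Sublist.DecPropositional _≟ᵛ_ using (_⊆?_)
open import Data.List.Relation.Unary.Unique.DecPropositional _≟ᵛ_ using (unique?)

adjacent? : Binary.Decidable PetersenAdj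
adjacent? (A i) (A j) = (j ≟ i ⊕ 2) ⊎-dec (i ≟ j ⊕ 2)
adjacent? (A i) (B j) = i ≟ j
adjacent? (B i) (A j) = i ≟ j
adjacent? (B i) (B j) = (j ≟ i ⊕ 1) ⊎-dec (i ≟ j ⊕ 1)

allVertices? : {P : Pred PetersenVertex p} → Decidable P → Dec (∀ v → P v)
allVertices? P? =
  map′ (λ { (a , b) (A i) → a i ; (a , b) (B i) → b i })
       (λ f → f ∘ A , f ∘ B)
       (all? (P? ∘ A) ×-dec all? (P? ∘ B))

-- The proof fields of `Cycle` as one decidable predicate, by which candidate lists can be filtered.
IsCycle : PetersenVertex → List PetersenVertex → Set
IsCycle v vs = 3 ≤ length (v ∷ vs) × List.Unique (v ∷ vs) × Linked PetersenAdj ((v ∷ vs) ∷ʳ v)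

isCycle? : ∀ v → Decidable (IsCycle v)
isCycle? v vs =
  (3 ≤? length (v ∷ vs)) ×-dec unique? (v ∷ vs) ×-dec linked? adjacent? ((v ∷ vs) ∷ʳ v)

-- Modulo 5, `⊕ 3` and `⊕ 4` are subtraction of 2 and of 1.
neighbours : PetersenVertex → List PetersenVertex
neighbours (A i) = B i ∷ A (i ⊕ 2) ∷ A (i ⊕ 3) ∷ []
neighbours (B i) = A i ∷ B (i ⊕ 1) ∷ B (i ⊕ 4) ∷ []

-- The lists omit the starting vertex.
pathsAvoiding : List PetersenVertex → ℕ → PetersenVertex → List (List PetersenVertex)
pathsAvoiding seen zero    v = [ [] ]
pathsAvoiding seen (suc n) v =
  concatMap (λ w → map (w ∷_) (pathsAvoiding (w ∷ seen) n w)) (filter (_∉? seen) (neighbours v))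

-- Since `v` itself is omitted, 8 and 7 steps give cycles of length 9 and 8. The filter discards the
-- paths whose last vertex is not adjacent to `v`.
longCyclesFrom : PetersenVertex → List (List PetersenVertex)
longCyclesFrom v =
  filter (isCycle? v) (pathsAvoiding [ v ] 8 v ++ pathsAvoiding [ v ] 7 v)

CoversTriples : PetersenVertex → List (List PetersenVertex) → Set
CoversTriples v cs = ∀ w x y → Vec.Unique (v ∷ w ∷ x ∷ y ∷ []) → Any ((w ∷ x ∷ y ∷ []) ⊆_) cs

coversTriples? : ∀ v → Decidable (CoversTriples v)
coversTriples? v cs =
  allVertices? λ w → allVertices? λ x → allVertices? λ y →
    Vec.allPairs? (λ s t → ¬? (s ≟ᵛ t)) (v ∷ w ∷ x ∷ y ∷ []) →-dec
    any? ((w ∷ x ∷ y ∷ []) ⊆?_) cs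

-- Evaluation over all quadruples of vertices; those with a repeated entry pass vacuously.
longCyclesFrom-coverTriples : ∀ v → CoversTriples v (longCyclesFrom v)
longCyclesFrom-coverTriples =
  does⁻ (allVertices? λ v → coversTriples? v (longCyclesFrom v)) refl

-- Soundness comes from the filter alone, whatever the path search produces.
longCyclesFrom-areCycles : ∀ v → All (IsCycle v) (longCyclesFrom v)
longCyclesFrom-areCycles v =
  all-filter (isCycle? v) (pathsAvoiding [ v ] 8 v ++ pathsAvoiding [ v ] 7 v)

containing-cycle : ∀ {v vs css} → All (IsCycle v) css → Any (vs ⊆_) css →
                   ∃[ C ] ContainsInCyclicOrder {Petersen} C (v ∷ vs)
containing-cycle {v} {vs} areCycles found
  with (long , unique , closed) , vs⊆cs ← All.lookupAny areCycles found
  = record { long = long ; distinct = unique ; closed = closed }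
  -- The cycle already starts at `v`, so the trivial rotation serves: `xs` is empty and `v` matches
  -- the head. `++-identityʳ` accounts for the trailing `++ []`.
  , [] , _ , refl , subst ((v ∷ vs) ⊆_) (sym (++-identityʳ _)) (refl ∷⊆ vs⊆cs)

theorem2p5 : Ordered 4 Petersen
theorem2p5 (v ∷ w ∷ x ∷ y ∷ []) distinct =
  containing-cycle (longCyclesFrom-areCycles v) (longCyclesFrom-coverTriples v w x y distinct)
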